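{- If $p$ is a prime and $r$ is a positive integer, then $p\in F_r$ if and only if $r<p<(p_{b(r)+1}-r)(p_{b(r)+2}-r)+r$.
   Context: $p_i$ denotes the $i$-th prime. For a positive integer $r$, $S_r$ is the multiplicative function with $S_r(q^\alpha)=0$ if $q\le r$ and $S_r(q^\alpha)=q^{\alpha-1}(q-r)$ if $q>r$ (for primes $q$, positive integers $\alpha$). $B_r=\{n\in\mathbb{N}: S_r(n)>0\}$, i.e. $1$ together with the positive integers whose smallest prime factor exceeds $r$. $F_r$ is the set of $n\in B_r$ such that $S_r(n)<S_r(m)$ for all $m\in B_r$ with $m>n$. $b(1)=0$, and for $r\ge 2$, $b(r)$ is the largest integer with $p_{b(r)}\le r$ (so $p_{b(r)+1}$ is the smallest prime exceeding $r$). -}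

module Defs where

open import Data.Nat using (ℕ; zero; suc; _+_; _*_; _∸_; _^_; _≤_; _<_; _≤?_; _/_)
open import Data.Nat.Divisibility using (_∣_; _∣?_)
open import Data.Nat.Primality using (Prime; prime?)
open import Data.List using (List; map; filter; upTo)
open import Data.Nat.ListAction using (product)
open import Data.Product using (_×_)
open import Relation.Nullary using (¬_; yes; no)

-- p-adic valuation v_q(n) (multiplicity of q in n), computed with fuel;
-- fuel n suffices for n ≥ 1 and q ≥ 2.  For q < 2 it returns 0 (never used).
valAux : ℕ → ℕ → ℕ → ℕ
valAux zero q n = 0
valAux (suc f) (suc (suc k)) (suc m) with suc (suc k) ∣? suc m
... | yes _ = suc (valAux f (suc (suc k)) (suc m / suc (suc k)))
... | no _  = 0
valAux (suc f) _ _ = 0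

val : ℕ → ℕ → ℕ
val q n = valAux n q n

-- S_r on prime powers q^α (α ≥ 1); value 1 for α = 0 (the empty factor).
Spp : ℕ → ℕ → ℕ → ℕ
Spp r q zero = 1
Spp r q (suc a) with q ≤? r
... | yes _ = 0
... | no _  = q ^ a * (q ∸ r)

S : ℕ → ℕ → ℕ
S r n = product (map (λ q → Spp r q (val q n)) (filter prime? (upTo (suc n))))

B : ℕ → ℕ → Set
B r n = (1 ≤ n) × (0 < S r n)

F : ℕ → ℕ → Set
F r n = B r n × (∀ m → B r m → n < m → S r n < S r m)

IsNextPrime : ℕ → ℕ → Set
IsNextPrime a q = Prime q × a < q × (∀ k → a < k → k < q → ¬ Prime k)

{-# OPTIONS --safe #-}

-- S_r p = p − r for a prime p > r, and a composite m ∈ B_r is divisible either by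
-- two distinct primes or by the square of a prime q > r.  In the first case
-- S_r m ≥ (q₁ − r)(q₂ − r); in the second S_r m ≥ q (q − r), which is again at least
-- (q₁ − r)(q₂ − r) because q₂ ≤ 2r + 1 ≤ q₁ + r.  Conversely, if p ∈ F_r then
-- comparing p with m = q₁ q, for a prime q > q₁ with p < q₁ q, gives
-- p < (q₁ − r)(q − r) + r.  If p ≥ q₁ q₂, take n = ⌊p / q₁⌋ and q the next prime after n:
-- q ≤ 2n makes (q₁ − r)(q − r) + r ≤ n q₁ ≤ p, so p < q₁ q₂ and q = q₂ is allowed.
--
-- Both parts use that the interval (n, 2n + 1] contains two primes.  This is Erdős's
-- argument for Bertrand's postulate, run on ℓ = (2n + 1) C(2n, n) ≥ 4^n: with N = 2n + 1,
-- ℓ divides lcm(1, …, N), so its prime powers are at most N; no prime in (N/3, n]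
-- divides it, and primorials satisfy k# ≤ 4^k.  A single prime in (n, N] would give
-- 4^n ≤ N^(1 + √N) 4^(N/3), which fails for large n.

module Submission where

open import Defs
open import Data.Bool using (T)
open import Data.List using (List; []; _∷_; _++_; map; filter; upTo)
open import Data.List.Membership.Propositional using (_∈_)
open import Data.List.Membership.Propositional.Properties using (∈-∃++; ∈-filter⁺; ∈-filter⁻; ∈-upTo⁺; ∈-map⁺)
open import Data.List.Relation.Binary.Permutation.Propositional using (_↭_; ↭-sym; ↭-trans; ↭-prep; ↭⇒↭ₛ)
open import Data.List.Relation.Binary.Permutation.Propositional.Properties using (shift; map⁺; ∈-resp-↭)
open import Data.List.Relation.Binary.Permutation.Setoid.Properties using (Unique-resp-↭)
open import Data.List.Relation.Unary.All as All using (_∷_)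
open import Data.List.Relation.Unary.AllPairs using (_∷_)
open import Data.List.Relation.Unary.Any using (here; there)
open import Data.List.Relation.Unary.Unique.Propositional using (Unique)
open import Data.List.Relation.Unary.Unique.Propositional.Properties using (filter⁺; upTo⁺)
open import Data.Nat
open import Data.Nat.Combinatorics using (_C_; nCk≡n!/k![n-k]!; k![n∸k]!∣n!; nCn≡1)
open import Data.Nat.Divisibility
open import Data.Nat.DivMod using (m≡m%n+[m/n]*n; m%n<n; m/n*n≤m; m/n*n≡m; m*n/n≡m)
open import Data.Nat.GCD using (gcd)
open import Data.Nat.Induction using (<-rec)
open import Data.Nat.LCM using (lcm; m∣lcm[m,n]; n∣lcm[m,n]; lcm-least; gcd*lcm)
open import Data.Nat.ListAction using (product)
open import Data.Nat.ListAction.Properties using (∈⇒∣product; product-↭)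
open import Data.Nat.Primality
open import Data.Nat.Primality.Factorisation using (factorise)
open import Data.Nat.Properties
open import Data.Nat.Tactic.RingSolver using (solve-∀)
open import Data.Product using (_×_; _,_; ∃; ∃₂; proj₁; proj₂)
open import Data.Sum using (_⊎_; inj₁; inj₂; [_,_]′)
open import Data.Unit using (tt)
open import Function.Bundles using (_⇔_; mk⇔)
open import Relation.Binary using (tri<; tri≈; tri>)
open import Relation.Binary.PropositionalEquality
  using (_≡_; _≢_; refl; sym; trans; cong; cong₂; subst; subst₂; setoid; module ≡-Reasoning)
open import Relation.Nullary using (¬_; yes; no; contradiction)
open import Relation.Nullary.Decidable using (from-yes)

-- Primes, prime powers and least common multiples

prime⇒>1 : ∀ {q} → Prime q → 1 < q
prime⇒>1 {q} q-prime = nonTrivial⇒n>1 q {{prime⇒nonTrivial q-prime}}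

prime⇒>0 : ∀ {q} → Prime q → 0 < q
prime⇒>0 q-prime = <-trans z<s (prime⇒>1 q-prime)

prime∣prime⇒≡ : ∀ {p q} → Prime p → Prime q → p ∣ q → p ≡ q
prime∣prime⇒≡ p-prime q-prime p∣q with prime⇒irreducible q-prime p∣q
... | inj₁ refl = contradiction p-prime ¬prime[1]
... | inj₂ p≡q  = p≡q

∃-prime-divisor : ∀ n → 1 < n → ∃ λ q → Prime q × q ∣ n
∃-prime-divisor n@(suc _) 1<n with factorise n
... | record { factors = [] ; isFactorisation = refl } = contradiction 1<n (<-irrefl refl)
... | record { factors = q ∷ qs ; isFactorisation = n≡ ; factorsPrime = q-prime ∷ _ } =
  q , q-prime , subst (q ∣_) (sym n≡) (m∣m*n _)

*-positiveʳ : ∀ m {n} → 0 < m * n → 0 < n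
*-positiveʳ m {zero}  mn>0 = contradiction mn>0 (<⇒≱ (s≤s (≤-reflexive (*-zeroʳ m))))
*-positiveʳ m {suc n} mn>0 = z<s

*-positive : ∀ {m n} → 0 < m → 0 < n → 0 < m * n
*-positive = *-mono-≤ {1} {_} {1}

^-positive : ∀ {m} → 0 < m → ∀ e → 0 < m ^ e
^-positive m>0 zero    = z<s
^-positive m>0 (suc e) = *-positive m>0 (^-positive m>0 e)

^-monoʳ-∣ : ∀ m {d e} → d ≤ e → m ^ d ∣ m ^ e
^-monoʳ-∣ m z≤n       = 1∣ _
^-monoʳ-∣ m (s≤s d≤e) = *-monoʳ-∣ m (^-monoʳ-∣ m d≤e)

prime∤* : ∀ {q} → Prime q → ∀ {a b} → q ∤ a → q ∤ b → q ∤ a * b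
prime∤* q-prime {a} {b} q∤a q∤b q∣ab = [ q∤a , q∤b ]′ (euclidsLemma a b q-prime q∣ab)

-- The exponent `e` is the multiplicity of `q` in `c`. The prime-counting argument works with this
-- decomposition rather than with the fuelled function `val`.
extract-power : ∀ {q} → 1 < q → ∀ c → 0 < c → ∃₂ λ e c′ → c ≡ q ^ e * c′ × q ∤ c′
extract-power {q} 1<q = <-rec _ step
  where
  step : ∀ c → (∀ {d} → d < c → 0 < d → ∃₂ λ e c′ → d ≡ q ^ e * c′ × q ∤ c′) →
         0 < c → ∃₂ λ e c′ → c ≡ q ^ e * c′ × q ∤ c′
  step c rec c>0 with q ∣? c
  ... | no q∤c = 0 , c , sym (*-identityˡ c) , q∤c
  ... | yes (divides d refl) with rec d<dq d>0
    where
    d>0 : 0 < d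
    d>0 = *-positiveʳ q (subst (0 <_) (*-comm d q) c>0)
    d<dq : d < d * q
    d<dq = m<m*n d q {{>-nonZero d>0}} 1<q
  ... | e , c′ , d≡ , q∤c′ =
    suc e , c′ , trans (cong (_* q) d≡) (lemma q (q ^ e) c′) , q∤c′
    where
    lemma : ∀ x y z → y * z * x ≡ x * y * z
    lemma = solve-∀

-- If `q ^ suc e` divides neither number, both have `q`-exponent at most `e`, so the lcm divides
-- `q ^ e * (a′ * b′)`, where `q` divides neither `a′` nor `b′`.
prime^∣lcm : ∀ {q} → Prime q → ∀ {a b} → 0 < a → 0 < b → ∀ e →
             q ^ e ∣ lcm a b → q ^ e ∣ a ⊎ q ^ e ∣ b
prime^∣lcm q-prime a>0 b>0 zero _ = inj₁ (1∣ _)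
prime^∣lcm {q} q-prime {a} {b} a>0 b>0 (suc e) q^∣lcm
  with (q ^ suc e) ∣? a | (q ^ suc e) ∣? b
... | yes q^∣a | _        = inj₁ q^∣a
... | no _     | yes q^∣b = inj₂ q^∣b
... | no q^∤a  | no q^∤b
  with extract-power (prime⇒>1 q-prime) a a>0 | extract-power (prime⇒>1 q-prime) b b>0
... | α , a′ , refl , q∤a′ | β , b′ , refl , q∤b′ =
  contradiction (*-cancelˡ-∣ (q ^ e) {{>-nonZero (^-positive (prime⇒>0 q-prime) e)}}
                  (subst (_∣ q ^ e * (a′ * b′)) (*-comm q (q ^ e)) (∣-trans q^∣lcm lcm∣)))
                (prime∤* q-prime q∤a′ q∤b′)
  where
  exponent-≤ : ∀ γ c′ → q ^ suc e ∤ q ^ γ * c′ → γ ≤ e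
  exponent-≤ γ c′ ∤ = ≮⇒≥ λ e<γ → ∤ (∣m⇒∣m*n c′ (^-monoʳ-∣ q e<γ))
  lcm∣ : lcm (q ^ α * a′) (q ^ β * b′) ∣ q ^ e * (a′ * b′)
  lcm∣ = lcm-least (*-pres-∣ (^-monoʳ-∣ q (exponent-≤ α a′ q^∤a)) (m∣m*n b′))
                   (*-pres-∣ (^-monoʳ-∣ q (exponent-≤ β b′ q^∤b)) (n∣m*n a′))

lcm-positive : ∀ {a b} → 0 < a → 0 < b → 0 < lcm a b
lcm-positive {a} {b} a>0 b>0 =
  *-positiveʳ (gcd a b) (subst (0 <_) (sym (gcd*lcm a b)) (*-positive a>0 b>0))

-- The witness is lcm(1, ..., n + 1), built one number at a time; by `prime^∣lcm` a power of `q`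
-- dividing it divides one of these numbers.
∃-common-multiple : ∀ {q} → Prime q → ∀ n → ∃ λ L → 0 < L ×
                    (∀ i → 0 < i → i ≤ suc n → i ∣ L) × (∀ e → q ^ e ∣ L → q ^ e ≤ suc n)
∃-common-multiple q-prime zero =
  1 , z<s , (λ { 1 _ _ → ∣-refl ; (2+ _) _ (s≤s ()) }) , λ _ → ∣⇒≤
∃-common-multiple {q} q-prime (suc n) with ∃-common-multiple q-prime n
... | L , L>0 , multiple , bound =
  lcm L (2+ n) , lcm-positive L>0 z<s , multiple′ , bound′
  where
  multiple′ : ∀ i → 0 < i → i ≤ 2+ n → i ∣ lcm L (2+ n)
  multiple′ i i>0 i≤ with m≤n⇒m<n∨m≡n i≤
  ... | inj₁ (s≤s i≤1+n) = ∣-trans (multiple i i>0 i≤1+n) (m∣lcm[m,n] L (2+ n))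
  ... | inj₂ refl        = n∣lcm[m,n] L (2+ n)
  bound′ : ∀ e → q ^ e ∣ lcm L (2+ n) → q ^ e ≤ 2+ n
  bound′ e q^∣lcm with prime^∣lcm q-prime L>0 z<s e q^∣lcm
  ... | inj₁ q^∣L   = m≤n⇒m≤1+n (bound e q^∣L)
  ... | inj₂ q^∣2+n = ∣⇒≤ q^∣2+n

-- Factorials and the Leibniz triangle

C-factorial : ∀ j k → ((j + k) C k) * (j ! * k !) ≡ (j + k) !
C-factorial j k = begin
  ((j + k) C k) * (j ! * k !)
    ≡⟨ cong₂ _*_ (nCk≡n!/k![n-k]! (m≤n+m k j)) denominator ⟩
  ((j + k) ! / (k ! * (j + k ∸ k) !)) * (k ! * (j + k ∸ k) !)
    ≡⟨ m/n*n≡m (k![n∸k]!∣n! (m≤n+m k j)) ⟩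
  (j + k) ! ∎
  where
  open ≡-Reasoning
  instance _ = k !* (j + k ∸ k) !≢0
  denominator : j ! * k ! ≡ k ! * (j + k ∸ k) !
  denominator = trans (*-comm (j !) (k !)) (cong (λ i → k ! * i !) (sym (m+n∸n≡m j k)))

-- The reciprocals of these numbers form the Leibniz harmonic triangle.
leibniz : ℕ → ℕ → ℕ
leibniz j k = suc (j + k) * ((j + k) C k)

leibniz-factorial : ∀ j k → leibniz j k * (j ! * k !) ≡ suc (j + k) !
leibniz-factorial j k = trans (*-assoc (suc (j + k)) ((j + k) C k) (j ! * k !)) (cong (suc (j + k) *_) (C-factorial j k))

-- After multiplication by `j ! * k !` both sides equal (j + k + 2)!.
leibniz-sucʳ : ∀ j k → leibniz j (suc k) * suc k ≡ leibniz j k * (2+ (j + k))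
leibniz-sucʳ j k = *-cancelʳ-≡ _ _ (j ! * k !) {{j !* k !≢0}} (begin
  leibniz j (suc k) * suc k * (j ! * k !)     ≡⟨ rearrange (leibniz j (suc k)) (suc k) (j !) (k !) ⟩
  leibniz j (suc k) * (j ! * suc k !)         ≡⟨ leibniz-factorial j (suc k) ⟩
  suc (j + suc k) !                           ≡⟨ cong (λ i → suc i !) (+-suc j k) ⟩
  (2+ (j + k)) * suc (j + k) !                ≡⟨ cong (2+ (j + k) *_) (leibniz-factorial j k) ⟨
  (2+ (j + k)) * (leibniz j k * (j ! * k !))  ≡⟨ rearrange′ (2+ (j + k)) (leibniz j k) (j ! * k !) ⟩
  leibniz j k * (2+ (j + k)) * (j ! * k !)    ∎)
  where
  open ≡-Reasoning
  rearrange : ∀ x y z w → x * y * (z * w) ≡ x * (z * (y * w))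
  rearrange = solve-∀
  rearrange′ : ∀ x y z → x * (y * z) ≡ y * x * z
  rearrange′ = solve-∀

leibniz-sym : ∀ j k → leibniz j k ≡ leibniz k j
leibniz-sym j k = *-cancelʳ-≡ _ _ (j ! * k !) {{j !* k !≢0}} (begin
  leibniz j k * (j ! * k !) ≡⟨ leibniz-factorial j k ⟩
  suc (j + k) !             ≡⟨ cong (λ i → suc i !) (+-comm j k) ⟩
  suc (k + j) !             ≡⟨ leibniz-factorial k j ⟨
  leibniz k j * (k ! * j !) ≡⟨ cong (leibniz k j *_) (*-comm (k !) (j !)) ⟩
  leibniz k j * (j ! * k !) ∎)
  where open ≡-Reasoning

leibniz-sucˡ : ∀ j k → leibniz (suc j) k * suc j ≡ leibniz j k * (2+ (j + k))
leibniz-sucˡ j k = begin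
  leibniz (suc j) k * suc j    ≡⟨ cong (_* suc j) (leibniz-sym (suc j) k) ⟩
  leibniz k (suc j) * suc j    ≡⟨ leibniz-sucʳ k j ⟩
  leibniz k j * (2+ (k + j))   ≡⟨ cong₂ (λ x i → x * (2+ i)) (leibniz-sym k j) (+-comm k j) ⟩
  leibniz j k * (2+ (j + k))   ∎
  where open ≡-Reasoning

-- 1/leibniz j (k+1) = 1/leibniz j k − 1/leibniz (j+1) k, multiplied through by L.
leibniz∣ : ∀ j k {L} → (∀ i → 0 < i → i ≤ suc (j + k) → i ∣ L) → leibniz j k ∣ L
leibniz∣ j zero {L} multiple =
  subst (_∣ L) (sym (trans (leibniz-sym j 0)
                           (trans (cong (suc j *_) (nCn≡1 j)) (*-identityʳ (suc j)))))
        (multiple (suc j) z<s (s≤s (m≤m+n j 0)))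
leibniz∣ j (suc k) {L} multiple
  with leibniz∣ j k (λ i i>0 i≤ → multiple i i>0 (≤-trans i≤ (s≤s (+-monoʳ-≤ j (n≤1+n k)))))
     | leibniz∣ (suc j) k (λ i i>0 i≤ → multiple i i>0 (≤-trans i≤ (≤-reflexive (cong suc (sym (+-suc j k))))))
... | divides x L≡x | divides y L≡y =
  ∣m+n∣m⇒∣n (subst (leibniz j (suc k) ∣_) (trans sum≡ (+-comm L _)) (m∣m*n x)) (m∣m*n y)
  where
  open ≡-Reasoning
  rearrange : ∀ a b c → a * b * c ≡ a * c * b
  rearrange = solve-∀
  rearrange′ : ∀ a b c → a * c * b ≡ c * (b * a)
  rearrange′ = solve-∀
  distribute : ∀ j k L → L * (2+ (j + k)) ≡ L * suc k + L * suc j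
  distribute = solve-∀
  factor : ∀ k L w → L * suc k + w * suc k ≡ (L + w) * suc k
  factor = solve-∀
  numerator : leibniz j (suc k) * x * suc k ≡ L * (2+ (j + k))
  numerator = begin
    leibniz j (suc k) * x * suc k     ≡⟨ rearrange (leibniz j (suc k)) x (suc k) ⟩
    leibniz j (suc k) * suc k * x     ≡⟨ cong (_* x) (leibniz-sucʳ j k) ⟩
    leibniz j k * (2+ (j + k)) * x    ≡⟨ rearrange (leibniz j k) (2+ (j + k)) x ⟩
    leibniz j k * x * (2+ (j + k))    ≡⟨ cong (_* (2+ (j + k))) (trans (*-comm _ x) (sym L≡x)) ⟩
    L * (2+ (j + k))                  ∎
  subtrahend : leibniz j (suc k) * y * suc k ≡ L * suc j
  subtrahend = begin
    leibniz j (suc k) * y * suc k     ≡⟨ rearrange (leibniz j (suc k)) y (suc k) ⟩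
    leibniz j (suc k) * suc k * y     ≡⟨ cong (_* y) (trans (leibniz-sucʳ j k) (sym (leibniz-sucˡ j k))) ⟩
    leibniz (suc j) k * suc j * y     ≡⟨ rearrange (leibniz (suc j) k) (suc j) y ⟩
    leibniz (suc j) k * y * suc j     ≡⟨ cong (_* suc j) (trans (*-comm _ y) (sym L≡y)) ⟩
    L * suc j                         ∎
  sum≡ : leibniz j (suc k) * x ≡ L + leibniz j (suc k) * y
  sum≡ = *-cancelʳ-≡ _ _ (suc k) (begin
    leibniz j (suc k) * x * suc k               ≡⟨ numerator ⟩
    L * (2+ (j + k))                            ≡⟨ distribute j k L ⟩
    L * suc k + L * suc j                       ≡⟨ cong (L * suc k +_) subtrahend ⟨
    L * suc k + leibniz j (suc k) * y * suc k   ≡⟨ factor k L _ ⟩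
    (L + leibniz j (suc k) * y) * suc k         ∎)

-- Plays the role of Legendre's formula in Erdős's argument: `leibniz j k` divides lcm(1, ..., j + k
-- + 1), whose prime powers are at most `j + k + 1`.
leibniz-prime^ : ∀ {q} → Prime q → ∀ j k e → q ^ e ∣ leibniz j k → q ^ e ≤ suc (j + k)
leibniz-prime^ q-prime j k e q^∣ with ∃-common-multiple q-prime (j + k)
... | _ , _ , multiple , bound = bound e (∣-trans q^∣ (leibniz∣ j k multiple))

leibniz-positive : ∀ j k → 0 < leibniz j k
leibniz-positive j k =
  *-positiveʳ (j ! * k !) (subst (0 <_) (trans (sym (leibniz-factorial j k)) (*-comm (leibniz j k) _)) (suc (j + k) !>0))
  where
  _!>0 : ∀ n → 0 < n !
  n !>0 = >-nonZero⁻¹ (n !) {{n !≢0}}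

-- The primorial bound

-- The ratio of consecutive diagonal entries is 4 + 2/(n + 1). It lies between 4 and 4(n + 2)/(n +
-- 1), which drives the two inductions that follow.
leibniz-diagonal-suc : ∀ n → leibniz (suc n) (suc n) * suc n ≡ 2 * (3 + 2 * n) * leibniz n n
leibniz-diagonal-suc n = begin
  leibniz (suc n) (suc n) * suc n         ≡⟨ leibniz-sucʳ (suc n) n ⟩
  leibniz (suc n) n * (2+ (suc n + n))    ≡⟨ cong (_* (2+ (suc n + n))) doubling ⟩
  leibniz n n * 2 * (2+ (suc n + n))      ≡⟨ rearrange (leibniz n n) n ⟩
  2 * (3 + 2 * n) * leibniz n n           ∎
  where
  open ≡-Reasoning
  rearrange : ∀ x n → x * 2 * (2+ (suc n + n)) ≡ 2 * (3 + 2 * n) * x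
  rearrange = solve-∀
  rearrange′ : ∀ x n → x * (2+ (n + n)) ≡ x * 2 * suc n
  rearrange′ = solve-∀
  doubling : leibniz (suc n) n ≡ leibniz n n * 2
  doubling = *-cancelʳ-≡ _ _ (suc n) (trans (leibniz-sucˡ n n) (rearrange′ (leibniz n n) n))

4^n≤leibniz : ∀ n → 4 ^ n ≤ leibniz n n
4^n≤leibniz zero    = ≤-refl
4^n≤leibniz (suc n) = *-cancelʳ-≤ _ _ (suc n) (begin
  4 * 4 ^ n * suc n              ≤⟨ *-monoˡ-≤ (suc n) (*-monoʳ-≤ 4 (4^n≤leibniz n)) ⟩
  4 * leibniz n n * suc n        ≤⟨ m≤m+n _ (2 * leibniz n n) ⟩
  4 * leibniz n n * suc n + 2 * leibniz n n ≡⟨ rearrange (leibniz n n) n ⟩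
  2 * (3 + 2 * n) * leibniz n n  ≡⟨ leibniz-diagonal-suc n ⟨
  leibniz (suc n) (suc n) * suc n ∎)
  where
  open ≤-Reasoning
  rearrange : ∀ x n → 4 * x * suc n + 2 * x ≡ 2 * (3 + 2 * n) * x
  rearrange = solve-∀

leibniz≤[1+n]4^n : ∀ n → leibniz n n ≤ suc n * 4 ^ n
leibniz≤[1+n]4^n zero    = ≤-refl
leibniz≤[1+n]4^n (suc n) = *-cancelʳ-≤ _ _ (suc n) (begin
  leibniz (suc n) (suc n) * suc n       ≡⟨ leibniz-diagonal-suc n ⟩
  2 * (3 + 2 * n) * leibniz n n         ≤⟨ *-monoʳ-≤ (2 * (3 + 2 * n)) (leibniz≤[1+n]4^n n) ⟩
  2 * (3 + 2 * n) * (suc n * 4 ^ n)     ≤⟨ m≤m+n _ (2 * (suc n * 4 ^ n)) ⟩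
  2 * (3 + 2 * n) * (suc n * 4 ^ n) + 2 * (suc n * 4 ^ n) ≡⟨ rearrange (4 ^ n) n ⟩
  (2+ n) * (4 * 4 ^ n) * suc n          ∎)
  where
  open ≤-Reasoning
  rearrange : ∀ x n → 2 * (3 + 2 * n) * (suc n * x) + 2 * (suc n * x) ≡ (2+ n) * (4 * x) * suc n
  rearrange = solve-∀

-- `leibniz m m` is `suc m` times this coefficient, so the factor `suc m` cancels from the upper
-- bound on the diagonal.
C[2m+1,m]≤4^m : ∀ m → (suc m + m) C m ≤ 4 ^ m
C[2m+1,m]≤4^m m = *-cancelˡ-≤ (suc m) (subst (_≤ suc m * 4 ^ m) leibniz≡ (leibniz≤[1+n]4^n m))
  where
  open ≡-Reasoning
  rearrange : ∀ w x y z → x * (w * y * z) ≡ w * x * (y * z)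
  rearrange = solve-∀
  leibniz≡ : leibniz m m ≡ suc m * ((suc m + m) C m)
  leibniz≡ = *-cancelʳ-≡ _ _ (m ! * m !) {{m !* m !≢0}} (begin
    leibniz m m * (m ! * m !)                  ≡⟨ leibniz-factorial m m ⟩
    (suc m + m) !                              ≡⟨ C-factorial (suc m) m ⟨
    ((suc m + m) C m) * (suc m ! * m !)        ≡⟨ rearrange (suc m) ((suc m + m) C m) (m !) (m !) ⟩
    suc m * ((suc m + m) C m) * (m ! * m !)    ∎)

prime∤! : ∀ {q} → Prime q → ∀ m → m < q → q ∤ m !
prime∤! q-prime zero    _   = >⇒∤ (prime⇒>1 q-prime)
prime∤! q-prime (suc m) m<q = prime∤* q-prime (>⇒∤ m<q) (prime∤! q-prime m (<-trans (n<1+n m) m<q))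

n∣n! : ∀ n → 0 < n → n ∣ n !
n∣n! (suc n) _ = m∣m*n (n !)

primorial : ℕ → ℕ
primorial zero    = 1
primorial (suc n) with prime? (suc n)
... | yes _ = suc n * primorial n
... | no _  = primorial n

primorial-positive : ∀ n → 0 < primorial n
primorial-positive zero    = z<s
primorial-positive (suc n) with prime? (suc n)
... | yes _ = *-positive {suc n} z<s (primorial-positive n)
... | no _  = primorial-positive n

prime∣primorial⇒≤ : ∀ {q} → Prime q → ∀ n → q ∣ primorial n → q ≤ n
prime∣primorial⇒≤ q-prime zero    q∣1 = contradiction q∣1 (>⇒∤ (prime⇒>1 q-prime))
prime∣primorial⇒≤ q-prime (suc n) q∣  with prime? (suc n)
... | no _  = m≤n⇒m≤1+n (prime∣primorial⇒≤ q-prime n q∣)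
... | yes _ with euclidsLemma (suc n) (primorial n) q-prime q∣
...   | inj₁ q∣1+n = ∣⇒≤ q∣1+n
...   | inj₂ q∣n#  = m≤n⇒m≤1+n (prime∣primorial⇒≤ q-prime n q∣n#)

-- A new prime divides `x` but not the product of the smaller primes, so it divides the cofactor `y`
-- left by the induction hypothesis.
primorial-+-∣ : ∀ a j {x} → (∀ q → Prime q → a < q → q ≤ j + a → q ∣ x) →
                primorial (j + a) ∣ primorial a * x
primorial-+-∣ a zero    divisor = m∣m*n _
primorial-+-∣ a (suc j) {x} divisor
  with primorial-+-∣ a j (λ q q-prime a<q q≤ → divisor q q-prime a<q (m≤n⇒m≤1+n q≤)) | prime? (suc (j + a))
... | ih           | no _        = ih
... | divides y eq | yes q-prime
  with euclidsLemma y (primorial (j + a)) q-prime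
         (subst (suc (j + a) ∣_) eq
                (∣n⇒∣m*n (primorial a) (divisor (suc (j + a)) q-prime (s≤s (m≤n+m a j)) ≤-refl)))
...   | inj₁ q∣y = subst (suc (j + a) * primorial (j + a) ∣_) (sym eq) (*-monoˡ-∣ (primorial (j + a)) q∣y)
...   | inj₂ q∣# = contradiction (prime∣primorial⇒≤ q-prime (j + a) q∣#) 1+n≰n

-- Such a `q` divides (2m + 1)! but neither (m + 1)! nor m!.
prime∣C[2m+1,m] : ∀ {q} → Prime q → ∀ m → suc m < q → q ≤ suc m + m → q ∣ (suc m + m) C m
prime∣C[2m+1,m] {q} q-prime m m<q q≤
  with euclidsLemma ((suc m + m) C m) (suc m ! * m !) q-prime
         (subst (q ∣_) (sym (C-factorial (suc m) m))
                (∣-trans (n∣n! q (prime⇒>0 q-prime)) (m≤n⇒m!∣n! q≤)))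
... | inj₁ q∣C = q∣C
... | inj₂ q∣! = contradiction q∣! (prime∤* q-prime (prime∤! q-prime (suc m) m<q)
                                                    (prime∤! q-prime m (<-trans (n<1+n m) m<q)))

even⊎odd : ∀ n → ∃ λ m → n ≡ m + m ⊎ n ≡ suc (m + m)
even⊎odd zero = 0 , inj₁ refl
even⊎odd (suc n) with even⊎odd n
... | m , inj₁ n≡ = m , inj₂ (cong suc n≡)
... | m , inj₂ n≡ = suc m , inj₁ (cong suc (trans n≡ (sym (+-suc m m))))

¬prime-double : ∀ m → 1 < m → ¬ Prime (m + m)
¬prime-double m 1<m 2m-prime with prime⇒irreducible 2m-prime (∣m∣n⇒∣m+n (∣-refl {m}) ∣-refl)
... | inj₁ m≡1  = <⇒≢ 1<m (sym m≡1)
... | inj₂ m≡2m = <⇒≢ (m<m+n m (<-trans z<s 1<m)) m≡2m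

primorial-step-composite : ∀ n → ¬ Prime (suc n) → primorial (suc n) ≡ primorial n
primorial-step-composite n ¬prime with prime? (suc n)
... | yes 1+n-prime = contradiction 1+n-prime ¬prime
... | no _      = refl

-- Strong induction. An even n > 2 is not prime, so its primorial is that of n - 1. For n = 2m + 1
-- the primes in (m + 1, n] all divide C(2m + 1, m) ≤ 4^m, and the others contribute at most 4^(m +
-- 1).
primorial≤4^n : ∀ n → primorial n ≤ 4 ^ n
primorial≤4^n = <-rec _ step
  where
  open ≤-Reasoning
  step : ∀ n → (∀ {m} → m < n → primorial m ≤ 4 ^ m) → primorial n ≤ 4 ^ n
  step n rec with even⊎odd n
  ... | zero        , inj₁ refl = ≤-refl
  ... | 1           , inj₁ refl = ≤ᵇ⇒≤ 2 16 tt
  ... | m@(2+ m′)   , inj₁ refl = begin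
    primorial (m + m)        ≡⟨ primorial-step-composite (suc m′ + m) (¬prime-double m (s≤s (s≤s z≤n))) ⟩
    primorial (suc m′ + m)   ≤⟨ rec ≤-refl ⟩
    4 ^ (suc m′ + m)         ≤⟨ ^-monoʳ-≤ 4 (n≤1+n (suc m′ + m)) ⟩
    4 ^ (m + m)              ∎
  ... | zero        , inj₂ refl = ≤ᵇ⇒≤ 1 4 tt
  ... | m@(suc m′)  , inj₂ refl = begin
    primorial (suc (m + m))                ≡⟨ cong primorial (+-suc m m) ⟨
    primorial (m + suc m)                  ≤⟨ ∣⇒≤ {{>-nonZero (*-positive (primorial-positive (suc m)) C>0)}}
                                                  (primorial-+-∣ (suc m) m divisor) ⟩
    primorial (suc m) * ((suc m + m) C m)  ≤⟨ *-mono-≤ (rec (s≤s (m<m+n m z<s))) (C[2m+1,m]≤4^m m) ⟩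
    4 ^ suc m * 4 ^ m                      ≡⟨ ^-distribˡ-+-* 4 (suc m) m ⟨
    4 ^ suc (m + m)                        ∎
    where
    C>0 : 0 < (suc m + m) C m
    C>0 = *-positiveʳ (suc m ! * m !)
            (subst (0 <_) (trans (sym (C-factorial (suc m) m)) (*-comm ((suc m + m) C m) (suc m ! * m !)))
                   (>-nonZero⁻¹ _ {{(suc m + m) !≢0}}))
    divisor : ∀ q → Prime q → suc m < q → q ≤ m + suc m → q ∣ (suc m + m) C m
    divisor q q-prime m<q q≤ = prime∣C[2m+1,m] q-prime m m<q (≤-trans q≤ (≤-reflexive (+-suc m m)))

-- Primes in (N/3, n] and the diagonal Leibniz numbers

factorial-prime-part : ∀ {q} → Prime q → ∀ a b → b < q →
                       ∃ λ x → (a * q + b) ! ≡ q ^ a * a ! * x × q ∤ x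
factorial-prime-part q-prime zero zero _ = 1 , refl , >⇒∤ (prime⇒>1 q-prime)
-- The number after `a * q + q′` is the multiple `suc a * q`: it turns `q ^ a` into `q ^ suc a` and
-- `a !` into `suc a !`, leaving `x` alone.
factorial-prime-part {q@(suc q′)} q-prime (suc a) zero _ with factorial-prime-part q-prime a q′ ≤-refl
... | x , eq , q∤x = x , eq′ , q∤x
  where
  open ≡-Reasoning
  rearrange : ∀ u v w a x → u * suc a * (v * w * x) ≡ u * v * (suc a * w) * x
  rearrange = solve-∀
  index : suc a * q + 0 ≡ suc (a * q + q′)
  index = cong suc (trans (+-identityʳ _) (+-comm q′ (a * q)))
  eq′ : (suc a * q + 0) ! ≡ q ^ suc a * suc a ! * x
  eq′ = begin
    (suc a * q + 0) !                  ≡⟨ cong _! index ⟩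
    suc (a * q + q′) * (a * q + q′) !  ≡⟨ cong₂ _*_ (trans (cong suc (+-comm (a * q) q′)) (*-comm (suc a) q)) eq ⟩
    q * suc a * (q ^ a * a ! * x)      ≡⟨ rearrange q (q ^ a) (a !) a x ⟩
    q ^ suc a * suc a ! * x            ∎
-- Since 0 < `suc b` < `q`, the new factor is prime to `q` and is absorbed into `x`.
factorial-prime-part {q} q-prime a (suc b) b<q with factorial-prime-part q-prime a b (<-trans (n<1+n b) b<q)
... | x , eq , q∤x = (a * q + suc b) * x , eq′ , prime∤* q-prime q∤factor q∤x
  where
  open ≡-Reasoning
  q∤factor : q ∤ a * q + suc b
  q∤factor q∣ = >⇒∤ b<q (∣m+n∣m⇒∣n q∣ (n∣m*n a))
  rearrange : ∀ u v x → u * (v * x) ≡ v * (u * x)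
  rearrange = solve-∀
  eq′ : (a * q + suc b) ! ≡ q ^ a * a ! * ((a * q + suc b) * x)
  eq′ = begin
    (a * q + suc b) !                          ≡⟨ cong _! (+-suc (a * q) b) ⟩
    suc (a * q + b) * (a * q + b) !            ≡⟨ cong₂ _*_ (sym (+-suc (a * q) b)) eq ⟩
    (a * q + suc b) * (q ^ a * a ! * x)        ≡⟨ rearrange (a * q + suc b) (q ^ a * a !) x ⟩
    q ^ a * a ! * ((a * q + suc b) * x)        ∎

-- With n = q + b we have 2n + 1 = 2q + (2b + 1) and 2b + 1 < q, so n! = q x and (2n + 1)! = 2 q² y
-- with x and y prime to q. The powers of q cancel, leaving `leibniz n n * (x * x) ≡ 2 * y`.
prime∤leibniz : ∀ {q} → Prime q → ∀ n → 2 < q → q ≤ n → suc (n + n) < 3 * q → q ∤ leibniz n n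
prime∤leibniz {q} q-prime n 2<q q≤n 2n+1<3q q∣ℓ with m≤n⇒∃[o]m+o≡n q≤n
... | b , refl
  with factorial-prime-part q-prime 1 b b<q | factorial-prime-part q-prime 2 (suc (b + b)) 2b+1<q
  where
  double : ∀ q b → suc (q + b + (q + b)) ≡ q + q + suc (b + b)
  double = solve-∀
  triple : ∀ q → 3 * q ≡ q + q + q
  triple = solve-∀
  2b+1<q : suc (b + b) < q
  2b+1<q = +-cancelˡ-< (q + q) _ _ (subst (_≤ q + q + q) (cong suc (double q b)) (subst (suc (suc (q + b + (q + b))) ≤_) (triple q) 2n+1<3q))
  b<q : b < q
  b<q = ≤-<-trans (m≤n⇒m≤1+n (m≤m+n b b)) 2b+1<q
... | x , n!≡ , q∤x | y , [2n+1]!≡ , q∤y =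
  prime∤* q-prime (>⇒∤ 2<q) q∤y (subst (q ∣_) cancelled (∣m⇒∣m*n (x * x) q∣ℓ))
  where
  open ≡-Reasoning
  rearrange : ∀ q x l → l * (x * x) * (q * q) ≡ l * (q * 1 * 1 * x * (q * 1 * 1 * x))
  rearrange = solve-∀
  rearrange′ : ∀ q y → q * (q * 1) * 2 * y ≡ 2 * y * (q * q)
  rearrange′ = solve-∀
  index : ∀ q b → q + b ≡ 1 * q + b
  index = solve-∀
  index′ : ∀ q b → suc (q + b + (q + b)) ≡ 2 * q + suc (b + b)
  index′ = solve-∀
  n!≡′ : n ! ≡ q * 1 * 1 * x
  n!≡′ = trans (cong _! (index q b)) n!≡
  cancelled : leibniz n n * (x * x) ≡ 2 * y
  cancelled = *-cancelʳ-≡ _ _ (q * q) {{>-nonZero (*-positive (prime⇒>0 q-prime) (prime⇒>0 q-prime))}} (begin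
    leibniz n n * (x * x) * (q * q)  ≡⟨ rearrange q x (leibniz n n) ⟩
    leibniz n n * (q * 1 * 1 * x * (q * 1 * 1 * x)) ≡⟨ cong (λ z → leibniz n n * (z * z)) n!≡′ ⟨
    leibniz n n * (n ! * n !)        ≡⟨ leibniz-factorial n n ⟩
    suc (n + n) !                    ≡⟨ cong _! (index′ q b) ⟩
    (2 * q + suc (b + b)) !          ≡⟨ [2n+1]!≡ ⟩
    q * (q * 1) * 2 * y              ≡⟨ rearrange′ q y ⟩
    2 * y * (q * q)                  ∎)

-- Two primes between n and 2n + 1

Smooth : ℕ → ℕ → Set
Smooth k c = ∀ q → Prime q → q ∣ c → q ≤ k

PrimePowersBounded : ℕ → ℕ → Set
PrimePowersBounded N c = ∀ q → Prime q → ∀ e → q ^ e ∣ c → q ^ e ≤ N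

PrimePowersBounded-∣ : ∀ {N c d} → d ∣ c → PrimePowersBounded N c → PrimePowersBounded N d
PrimePowersBounded-∣ d∣c bounded q q-prime e q^∣d = bounded q q-prime e (∣-trans q^∣d d∣c)

PrimePowersBounded⇒>0 : ∀ {N c} → PrimePowersBounded N c → 0 < N
PrimePowersBounded⇒>0 bounded = bounded 2 prime[2] 0 (1∣ _)

Smooth-zero⇒≤1 : ∀ c → Smooth 0 c → c ≤ 1
Smooth-zero⇒≤1 c smooth = ≮⇒≥ λ 1<c →
  let q , q-prime , q∣c = ∃-prime-divisor c 1<c
  in contradiction (smooth q q-prime q∣c) (<⇒≱ (prime⇒>0 q-prime))

Smooth-pred : ∀ {k c d} → d ∣ c → Smooth (suc k) c → ¬ (Prime (suc k) × suc k ∣ d) → Smooth k d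
Smooth-pred d∣c smooth excluded q q-prime q∣d with m≤n⇒m<n∨m≡n (smooth q q-prime (∣-trans q∣d d∣c))
... | inj₁ (s≤s q≤k) = q≤k
... | inj₂ refl      = contradiction (q-prime , q∣d) excluded

-- There are at most `k` primes up to `k`, and each contributes a power of at most `N`.
smooth-power-bound : ∀ {N} k c → 0 < c → Smooth k c → PrimePowersBounded N c → c ≤ N ^ k
smooth-power-bound zero c c>0 smooth bounded = Smooth-zero⇒≤1 c smooth
smooth-power-bound {N} (suc k) c c>0 smooth bounded with prime? (suc k)
... | no ¬prime = ≤-trans
  (smooth-power-bound k c c>0 (Smooth-pred ∣-refl smooth λ { (q-prime , _) → ¬prime q-prime }) bounded)
  (m≤n*m (N ^ k) N {{>-nonZero (PrimePowersBounded⇒>0 bounded)}})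
... | yes q-prime with extract-power (prime⇒>1 q-prime) c c>0
...   | e , d , refl , q∤d = *-mono-≤ (bounded (suc k) q-prime e (m∣m*n d))
  (smooth-power-bound k d (*-positiveʳ (suc k ^ e) c>0)
    (Smooth-pred d∣c smooth λ { (_ , q∣d) → q∤d q∣d }) (PrimePowersBounded-∣ d∣c bounded))
  where
  d∣c : d ∣ suc k ^ e * d
  d∣c = n∣m*n (suc k ^ e)

^≤square⇒≤ : ∀ {q N} e → N < q * q → 0 < q → q ^ e ≤ N → q ^ e ≤ q
^≤square⇒≤ 0 _ q>0 _ = q>0
^≤square⇒≤ {q} 1 _ _ _ = ≤-reflexive (*-identityʳ q)
^≤square⇒≤ {q} (2+ e) N<q² q>0 q^≤N = contradiction (≤-<-trans q^≤N N<q²)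
  (≤⇒≯ (*-monoʳ-≤ q (m≤m*n q (q ^ e) {{>-nonZero (^-positive q>0 e)}})))

-- Prime powers are at most N, and the primes above s occur at most once.
smooth-primorial-bound : ∀ {N} s k c → N < suc s * suc s → 0 < c → Smooth k c →
                         PrimePowersBounded N c → c ≤ N ^ s * primorial k
smooth-primorial-bound {N} s k c N<s² c>0 smooth bounded with k ≤? s
... | yes k≤s = begin
  c                      ≤⟨ smooth-power-bound k c c>0 smooth bounded ⟩
  N ^ k                  ≤⟨ ^-monoʳ-≤ N {{N≢0}} k≤s ⟩
  N ^ s                  ≤⟨ m≤m*n (N ^ s) (primorial k) {{>-nonZero (primorial-positive k)}} ⟩
  N ^ s * primorial k    ∎
  where
  open ≤-Reasoning
  N≢0 : NonZero N
  N≢0 = >-nonZero (PrimePowersBounded⇒>0 bounded)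
smooth-primorial-bound {N} s zero c N<s² c>0 smooth bounded | no 0≰s = contradiction z≤n 0≰s
smooth-primorial-bound {N} s (suc k) c N<s² c>0 smooth bounded | no k≰s with prime? (suc k)
... | no ¬prime =
  smooth-primorial-bound s k c N<s² c>0 (Smooth-pred ∣-refl smooth λ { (q-prime , _) → ¬prime q-prime }) bounded
... | yes q-prime with extract-power (prime⇒>1 q-prime) c c>0
...   | e , d , refl , q∤d = begin
  suc k ^ e * d                    ≤⟨ *-mono-≤ q^≤q d≤ ⟩
  suc k * (N ^ s * primorial k)    ≡⟨ rearrange (suc k) (N ^ s) (primorial k) ⟩
  N ^ s * (suc k * primorial k)    ∎
  where
  open ≤-Reasoning
  rearrange : ∀ x y z → x * (y * z) ≡ y * (x * z)
  rearrange = solve-∀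
  d∣c : d ∣ suc k ^ e * d
  d∣c = n∣m*n (suc k ^ e)
  s<q : suc s ≤ suc k
  s<q = ≰⇒> k≰s
  q^≤q : suc k ^ e ≤ suc k
  q^≤q = ^≤square⇒≤ e (<-≤-trans N<s² (*-mono-≤ s<q s<q)) z<s (bounded (suc k) q-prime e (m∣m*n d))
  d≤ : d ≤ N ^ s * primorial k
  d≤ = smooth-primorial-bound s k d N<s² (*-positiveʳ (suc k ^ e) c>0)
         (Smooth-pred d∣c smooth λ { (_ , q∣d) → q∤d q∣d }) (PrimePowersBounded-∣ d∣c bounded)

-- Splitting off the power of `q₁` costs one factor N and leaves a cofactor with all primes at most
-- N/3: those in (N/3, n] do not divide `leibniz n n`, and q₁ is the only prime that (n, N] can
-- contain.
one-prime-bound : ∀ {n q₁ q₂} → 3 ≤ n → IsNextPrime n q₁ → IsNextPrime q₁ q₂ → suc (n + n) < q₂ →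
                  ∀ s → suc (n + n) < suc s * suc s →
                  4 ^ n ≤ suc (n + n) ^ suc s * 4 ^ (suc (n + n) / 3)
one-prime-bound {n} {q₁} {q₂} 3≤n (q₁-prime , n<q₁ , gap₁) (q₂-prime , q₁<q₂ , gap₂) N<q₂ s N<s²
  with extract-power (prime⇒>1 q₁-prime) (leibniz n n) (leibniz-positive n n)
... | e , d , ℓ≡ , q₁∤d = begin
  4 ^ n                              ≤⟨ 4^n≤leibniz n ⟩
  leibniz n n                        ≡⟨ ℓ≡ ⟩
  q₁ ^ e * d                         ≤⟨ *-mono-≤ (bounded q₁ q₁-prime e (subst (q₁ ^ e ∣_) (sym ℓ≡) (m∣m*n d)))
                                          (smooth-primorial-bound s M d N<s² d>0 smooth (PrimePowersBounded-∣ d∣ℓ bounded)) ⟩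
  N * (N ^ s * primorial M)          ≤⟨ *-monoʳ-≤ N (*-monoʳ-≤ (N ^ s) (primorial≤4^n M)) ⟩
  N * (N ^ s * 4 ^ M)                ≡⟨ *-assoc N (N ^ s) (4 ^ M) ⟨
  N ^ suc s * 4 ^ M                  ∎
  where
  open ≤-Reasoning
  N = suc (n + n)
  M = N / 3
  bounded : PrimePowersBounded N (leibniz n n)
  bounded q q-prime = leibniz-prime^ q-prime n n
  d∣ℓ : d ∣ leibniz n n
  d∣ℓ = subst (d ∣_) (sym ℓ≡) (n∣m*n (q₁ ^ e))
  d>0 : 0 < d
  d>0 = *-positiveʳ (q₁ ^ e) (subst (0 <_) ℓ≡ (leibniz-positive n n))
  N<3q : ∀ {q} → M < q → N < 3 * q
  N<3q {q} M<q = begin-strict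
    N               ≡⟨ m≡m%n+[m/n]*n N 3 ⟩
    N % 3 + M * 3   <⟨ +-monoˡ-< (M * 3) (m%n<n N 3) ⟩
    suc M * 3       ≤⟨ *-monoˡ-≤ 3 M<q ⟩
    q * 3           ≡⟨ *-comm q 3 ⟩
    3 * q           ∎
  -- Together with N < 3q this gives 6 < 3q, the condition 2 < q of `prime∤leibniz`.
  7≤N : 7 ≤ N
  7≤N = s≤s (+-mono-≤ 3≤n 3≤n)
  smooth : Smooth M d
  smooth q q-prime q∣d = ≮⇒≥ excluded
    where
    q≤N : q ≤ N
    q≤N = subst (_≤ N) (*-identityʳ q)
            (bounded q q-prime 1 (subst (_∣ leibniz n n) (sym (*-identityʳ q)) (∣-trans q∣d d∣ℓ)))
    excluded : ¬ M < q
    excluded M<q with q ≤? n | <-cmp q q₁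
    ... | yes q≤n | _ = prime∤leibniz q-prime n (*-cancelˡ-< 3 2 q (≤-<-trans (≤-trans (n≤1+n 6) 7≤N) (N<3q M<q)))
                          q≤n (N<3q M<q) (∣-trans q∣d d∣ℓ)
    ... | no q≰n  | tri< q<q₁ _ _ = gap₁ q (≰⇒> q≰n) q<q₁ q-prime
    ... | no _    | tri≈ _ refl _ = q₁∤d q∣d
    ... | no _    | tri> _ _ q₁<q = gap₂ q q₁<q (≤-<-trans q≤N N<q₂) q-prime

-- Numerical estimates for large n

^-distribʳ-* : ∀ e m n → (m * n) ^ e ≡ m ^ e * n ^ e
^-distribʳ-* zero    m n = refl
^-distribʳ-* (suc e) m n = trans (cong (m * n *_) (^-distribʳ-* e m n)) (rearrange m n (m ^ e) (n ^ e))
  where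
  rearrange : ∀ a b c d → a * b * (c * d) ≡ a * c * (b * d)
  rearrange = solve-∀

-- This is (y/x)^e ≤ (l/k)^e ≤ 2, cleared of denominators.
ratio-power : ∀ k l e → 0 < k → l ^ e ≤ 2 * k ^ e → ∀ {x y} → k * y ≤ l * x → y ^ e ≤ 2 * x ^ e
ratio-power k l e k>0 l^e≤ {x} {y} ky≤lx = *-cancelˡ-≤ (k ^ e) {{>-nonZero (^-positive k>0 e)}} (begin
  k ^ e * y ^ e        ≡⟨ ^-distribʳ-* e k y ⟨
  (k * y) ^ e          ≤⟨ ^-monoˡ-≤ e ky≤lx ⟩
  (l * x) ^ e          ≡⟨ ^-distribʳ-* e l x ⟩
  l ^ e * x ^ e        ≤⟨ *-monoˡ-≤ (x ^ e) l^e≤ ⟩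
  2 * k ^ e * x ^ e    ≡⟨ rearrange (k ^ e) (x ^ e) ⟩
  k ^ e * (2 * x ^ e)  ∎)
  where
  open ≤-Reasoning
  rearrange : ∀ a b → 2 * a * b ≡ a * (2 * b)
  rearrange = solve-∀

-- For x ≥ 9 the ratio (x + 1)/x is at most 10/9, and (10/9)^6 < 2.
sixth-power-suc : ∀ x → 9 ≤ x → suc x ^ 6 ≤ 2 * x ^ 6
sixth-power-suc x 9≤x = ratio-power 9 10 6 z<s (≤ᵇ⇒≤ (10 ^ 6) (2 * 9 ^ 6) tt) {x} {suc x}
  (subst (_≤ 10 * x) (sym (expand x)) (+-monoˡ-≤ (9 * x) 9≤x))
  where
  expand : ∀ x → 9 * suc x ≡ 9 + 9 * x
  expand = solve-∀

-- Induction from 34^6 < 2^31: each step doubles the right side and at most doubles the left. At u =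
-- 30 the inequality still fails.
sixth-power-bound : ∀ u → 31 ≤ u → (3 + u) ^ 6 ≤ 2 ^ u
sixth-power-bound (suc u) 31≤1+u with m≤n⇒m<n∨m≡n 31≤1+u
... | inj₂ refl       = ≤ᵇ⇒≤ (34 ^ 6) (2 ^ 31) tt
... | inj₁ (s≤s 31≤u) = ≤-trans
  (sixth-power-suc (3 + u) (≤-trans (≤ᵇ⇒≤ 9 31 tt) (m≤n⇒m≤o+n 3 31≤u)))
  (*-monoʳ-≤ 2 (sixth-power-bound u 31≤u))

∃-sqrt : ∀ N → ∃ λ s → s * s ≤ N × N < suc s * suc s
∃-sqrt zero = 0 , z≤n , z<s
∃-sqrt (suc N) with ∃-sqrt N
... | s , s²≤N , N<s⁺² with suc N <? suc s * suc s
...   | yes N⁺<s⁺² = s , m≤n⇒m≤1+n s²≤N , N⁺<s⁺²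
...   | no N⁺≮s⁺²  = suc s , ≮⇒≥ N⁺≮s⁺² , ≤-<-trans N<s⁺² (*-mono-< {suc s} ≤-refl ≤-refl)

^-cancelˡ-≤ : ∀ m {j k} → 1 < m → m ^ j ≤ m ^ k → j ≤ k
^-cancelˡ-≤ m 1<m m^j≤m^k = ≮⇒≥ λ k<j → <⇒≱ (^-monoʳ-< m 1<m k<j) m^j≤m^k

-- With (u+3)^6 ≤ 2^u, the bound 4^n ≤ N^(u+3) 4^(N/3) forces N ≤ u(u+3) + 3 < (u+2)².
one-prime-bound-fails : ∀ n N t u → N ≡ suc (n + n) → t ≡ 3 + u → t ^ 6 ≤ 2 ^ u →
                        (2 + u) * (2 + u) ≤ N → N < t * t → ¬ (4 ^ n ≤ N ^ t * 4 ^ (N / 3))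
one-prime-bound-fails n N t u N≡ t≡3+u t^6≤2^u s²≤N N<t² 4^n≤ =
  <⇒≱ (<-≤-trans too-small s²≤N)
      (≤-trans (≤-reflexive N≡) (≤-trans (s≤s 2n≤) (≤-reflexive (sym (+-suc (u * t) 2)))))
  where
  too-small : u * t + 3 < (2 + u) * (2 + u)
  too-small = subst (λ t → u * t + 3 < (2 + u) * (2 + u)) (sym t≡3+u)
                    (subst (u * (3 + u) + 3 <_) (sym (expand u)) (s≤s (m≤m+n (u * (3 + u) + 3) u)))
    where
    expand : ∀ u → (2 + u) * (2 + u) ≡ suc (u * (3 + u) + 3 + u)
    expand = solve-∀
  open ≤-Reasoning
  -- Cubing removes the division by 3, since 4^(3(N/3)) ≤ 4^N = 2^(4n + 2). The other factor is at
  -- most (t²)^(3t) = (t^6)^t ≤ 2^(ut). The exponent 6n is written as 4n + 2n so that 4n cancels.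
  cubed : 2 ^ (4 * n + 2 * n) ≤ 2 ^ (4 * n + (u * t + 2))
  cubed = begin
    2 ^ (4 * n + 2 * n)                ≡⟨ cong (2 ^_) (exponent n) ⟩
    2 ^ (2 * (n * 3))                  ≡⟨ ^-*-assoc 2 2 (n * 3) ⟨
    4 ^ (n * 3)                        ≡⟨ ^-*-assoc 4 n 3 ⟨
    (4 ^ n) ^ 3                        ≤⟨ ^-monoˡ-≤ 3 4^n≤ ⟩
    (N ^ t * 4 ^ (N / 3)) ^ 3          ≡⟨ ^-distribʳ-* 3 (N ^ t) (4 ^ (N / 3)) ⟩
    (N ^ t) ^ 3 * (4 ^ (N / 3)) ^ 3    ≡⟨ cong₂ _*_ (^-*-assoc N t 3) (^-*-assoc 4 (N / 3) 3) ⟩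
    N ^ (t * 3) * 4 ^ (N / 3 * 3)      ≤⟨ *-mono-≤ (^-monoˡ-≤ (t * 3) (<⇒≤ N<t²)) (^-monoʳ-≤ 4 (m/n*n≤m N 3)) ⟩
    (t * t) ^ (t * 3) * 4 ^ N          ≡⟨ cong₂ _*_ square-power (^-*-assoc 2 2 N) ⟩
    (t ^ 6) ^ t * 2 ^ (2 * N)          ≤⟨ *-monoˡ-≤ (2 ^ (2 * N)) (^-monoˡ-≤ t t^6≤2^u) ⟩
    (2 ^ u) ^ t * 2 ^ (2 * N)          ≡⟨ cong (_* 2 ^ (2 * N)) (^-*-assoc 2 u t) ⟩
    2 ^ (u * t) * 2 ^ (2 * N)          ≡⟨ ^-distribˡ-+-* 2 (u * t) (2 * N) ⟨
    2 ^ (u * t + 2 * N)                ≡⟨ cong (2 ^_) (trans (cong (λ N → u * t + 2 * N) N≡) (exponent′ (u * t) n)) ⟩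
    2 ^ (4 * n + (u * t + 2))          ∎
    where
    exponent : ∀ n → 4 * n + 2 * n ≡ 2 * (n * 3)
    exponent = solve-∀
    exponent′ : ∀ w n → w + 2 * suc (n + n) ≡ 4 * n + (w + 2)
    exponent′ = solve-∀
    exponent″ : ∀ t → 2 * (t * 3) ≡ t * 6
    exponent″ = solve-∀
    square-power : (t * t) ^ (t * 3) ≡ (t ^ 6) ^ t
    square-power = begin-equality
      (t * t) ^ (t * 3)          ≡⟨ cong (λ x → (t * x) ^ (t * 3)) (*-identityʳ t) ⟨
      (t ^ 2) ^ (t * 3)          ≡⟨ ^-*-assoc t 2 (t * 3) ⟩
      t ^ (2 * (t * 3))          ≡⟨ cong (t ^_) (trans (exponent″ t) (*-comm t 6)) ⟩
      t ^ (6 * t)                ≡⟨ ^-*-assoc t 6 t ⟨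
      (t ^ 6) ^ t                ∎
  2n≤ : n + n ≤ u * t + 2
  2n≤ = subst (λ x → n + x ≤ u * t + 2) (+-identityʳ n)
          (+-cancelˡ-≤ (4 * n) (2 * n) (u * t + 2) (^-cancelˡ-≤ 2 (s≤s z<s) cubed))

-- The case t = s + 1, u = s - 2. As 1089 = 33², the root satisfies s ≥ 33, hence u ≥ 31 as
-- `sixth-power-bound` requires.
large-impossible : ∀ n N s → N ≡ suc (n + n) → 1089 ≤ N → s * s ≤ N → N < suc s * suc s →
                   ¬ (4 ^ n ≤ N ^ suc s * 4 ^ (N / 3))
large-impossible n N s N≡ 1089≤N s²≤N N<s⁺² =
  one-prime-bound-fails n N (suc s) (s ∸ 2) N≡ (cong suc s≡) t^6≤ (subst (λ x → x * x ≤ N) s≡ s²≤N) N<s⁺²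
  where
  33≤s : 33 ≤ s
  33≤s = ≮⇒≥ λ s<33 → <⇒≱ N<s⁺² (≤-trans (*-mono-≤ s<33 s<33) 1089≤N)
  s≡ : s ≡ 2 + (s ∸ 2)
  s≡ = sym (m+[n∸m]≡n (≤-trans (s≤s (s≤s z≤n)) 33≤s))
  t^6≤ : suc s ^ 6 ≤ 2 ^ (s ∸ 2)
  t^6≤ = subst (λ t → t ^ 6 ≤ 2 ^ (s ∸ 2)) (cong suc (sym s≡)) (sixth-power-bound (s ∸ 2) (∸-monoˡ-≤ 2 33≤s))

-- Small n, and two primes in (n, 2n + 1] for every n ≥ 1

next-prime-minimal : ∀ {n q a} → IsNextPrime n q → Prime a → n < a → q ≤ a
next-prime-minimal (_ , _ , gap) a-prime n<a = ≮⇒≥ λ a<q → gap _ n<a a<q a-prime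

module _ {n q₁ q₂ : ℕ} (next₁ : IsNextPrime n q₁) (next₂ : IsNextPrime q₁ q₂) where

  second-prime-≤ : ∀ {a b} → Prime a → Prime b → n < a → a < b → q₂ ≤ b
  second-prime-≤ a-prime b-prime n<a a<b =
    next-prime-minimal next₂ b-prime (≤-<-trans (next-prime-minimal next₁ a-prime n<a) a<b)

  -- One link of a chain: for l ≤ n < a the primes a < b ≤ 2l + 1 settle the claim, and n ≥ a goes
  -- to the next link. The comparisons are boolean, so `tt` proves them for numerals.
  second-next-prime-≤-from : ∀ l a b → Prime a → Prime b → T (a <ᵇ b) → T (b ≤ᵇ suc (l + l)) →
                             (a ≤ n → q₂ ≤ suc (n + n)) → l ≤ n → q₂ ≤ suc (n + n)
  second-next-prime-≤-from l a b a-prime b-prime a<b b≤ otherwise l≤n with n <? a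
  ... | no n≮a  = otherwise (≮⇒≥ n≮a)
  ... | yes n<a = ≤-trans (second-prime-≤ a-prime b-prime n<a (<ᵇ⇒< a b a<b))
                          (≤-trans (≤ᵇ⇒≤ b (suc (l + l)) b≤) (s≤s (+-mono-≤ l≤n l≤n)))

  second-next-prime-≤ : 1 ≤ n → q₂ ≤ suc (n + n)
  second-next-prime-≤ =
    -- Each link starts at the `a` of the link before, so together they cover 1 ≤ n < 769.
    second-next-prime-≤-from 1 2 3 (from-yes (prime? 2)) (from-yes (prime? 3)) tt tt (
    second-next-prime-≤-from 2 3 5 (from-yes (prime? 3)) (from-yes (prime? 5)) tt tt (
    second-next-prime-≤-from 3 5 7 (from-yes (prime? 5)) (from-yes (prime? 7)) tt tt (
    second-next-prime-≤-from 5 7 11 (from-yes (prime? 7)) (from-yes (prime? 11)) tt tt (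
    second-next-prime-≤-from 7 11 13 (from-yes (prime? 11)) (from-yes (prime? 13)) tt tt (
    second-next-prime-≤-from 11 19 23 (from-yes (prime? 19)) (from-yes (prime? 23)) tt tt (
    second-next-prime-≤-from 19 31 37 (from-yes (prime? 31)) (from-yes (prime? 37)) tt tt (
    second-next-prime-≤-from 31 59 61 (from-yes (prime? 59)) (from-yes (prime? 61)) tt tt (
    second-next-prime-≤-from 59 107 109 (from-yes (prime? 107)) (from-yes (prime? 109)) tt tt (
    second-next-prime-≤-from 107 199 211 (from-yes (prime? 199)) (from-yes (prime? 211)) tt tt (
    second-next-prime-≤-from 199 389 397 (from-yes (prime? 389)) (from-yes (prime? 397)) tt tt (
    second-next-prime-≤-from 389 769 773 (from-yes (prime? 769)) (from-yes (prime? 773)) tt tt (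
    large))))))))))))
    where
    large : 769 ≤ n → q₂ ≤ suc (n + n)
    large 769≤n = ≮⇒≥ λ N<q₂ →
      -- 544 is the least n with 2n + 1 ≥ 1089; the chain above passes it at 769.
      let 544≤n = ≤-trans (≤ᵇ⇒≤ 544 769 tt) 769≤n
          s , s²≤N , N<s⁺² = ∃-sqrt (suc (n + n))
      in large-impossible n (suc (n + n)) s refl (s≤s (+-mono-≤ 544≤n 544≤n)) s²≤N N<s⁺²
           (one-prime-bound (≤-trans (≤ᵇ⇒≤ 3 544 tt) 544≤n) next₁ next₂ N<q₂ s N<s⁺²)

-- The totients S_r

∃-prime> : ∀ n → ∃ λ q → Prime q × n < q
∃-prime> n with ∃-prime-divisor (n ! + 1) (+-monoˡ-≤ 1 (>-nonZero⁻¹ (n !) {{n !≢0}}))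
... | q , q-prime , q∣n!+1 = q , q-prime , ≰⇒> λ q≤n →
  >⇒∤ (prime⇒>1 q-prime) (∣m+n∣m⇒∣n q∣n!+1 (∣-trans (n∣n! q (prime⇒>0 q-prime)) (m≤n⇒m!∣n! q≤n)))

∃-next-prime : ∀ n → ∃ (IsNextPrime n)
∃-next-prime n with ∃-prime> n
... | p , p-prime , n<p with m≤n⇒∃[o]m+o≡n n<p
...   | j , n+j≡p = search (suc n) j n+j≡p ≤-refl λ i n<i i≤n → contradiction n<i (<⇒≱ i≤n)
  where
  search : ∀ k j → k + j ≡ p → n < k → (∀ i → n < i → i < k → ¬ Prime i) → ∃ (IsNextPrime n)
  search k j k+j≡p n<k gap with prime? k
  search k j       k+j≡p n<k gap | yes k-prime = k , k-prime , n<k , gap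
  search k zero    k+j≡p n<k gap | no ¬prime =
    contradiction (subst Prime (trans (sym k+j≡p) (+-identityʳ k)) p-prime) ¬prime
  search k (suc j) k+j≡p n<k gap | no ¬prime =
    search (suc k) j (trans (sym (+-suc k j)) k+j≡p) (m<n⇒m<1+n n<k) gap′
    where
    gap′ : ∀ i → n < i → i < suc k → ¬ Prime i
    gap′ i n<i (s≤s i≤k) with m≤n⇒m<n∨m≡n i≤k
    ... | inj₁ i<k  = gap i n<i i<k
    ... | inj₂ refl = ¬prime

-- The valuation function

valAux-∤ : ∀ f q n → q ∤ n → valAux f q n ≡ 0
valAux-∤ zero    q      n       q∤n = refl
valAux-∤ (suc f) 0      n       q∤n = refl
valAux-∤ (suc f) 1      n       q∤n = refl
valAux-∤ (suc f) (2+ k) zero    q∤n = refl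
valAux-∤ (suc f) (2+ k) (suc m) q∤n with 2+ k ∣? suc m
... | yes q∣n = contradiction q∣n q∤n
... | no _    = refl

valAux-* : ∀ f q m → 1 < q → 0 < m → valAux (suc f) q (m * q) ≡ suc (valAux f q m)
valAux-* f 1      m       (s≤s ()) _
valAux-* f (2+ k) (suc m) _ _ with 2+ k ∣? (suc m * 2+ k)
... | yes _   = cong (λ x → suc (valAux f (2+ k) x)) (m*n/n≡m (suc m) (2+ k))
... | no q∤mq = contradiction (n∣m*n (suc m)) q∤mq

-- After one division the remaining fuel is `pred (m * q)`, so the right side is phrased with
-- `valAux` and not with `val q m`.
val-* : ∀ q m → 1 < q → 0 < m → val q (m * q) ≡ suc (valAux (pred (m * q)) q m)
val-* q m 1<q m>0 = trans (cong (λ f → valAux f q (m * q)) (sym (suc-pred (m * q) {{>-nonZero (*-positive m>0 (<-trans z<s 1<q))}})))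
                          (valAux-* (pred (m * q)) q m 1<q m>0)

val≡1 : ∀ q m → 1 < q → 0 < m → q ∤ m → val q (m * q) ≡ 1
val≡1 q m 1<q m>0 q∤m = trans (val-* q m 1<q m>0) (cong suc (valAux-∤ (pred (m * q)) q m q∤m))

val≥1 : ∀ {q n} → 1 < q → 0 < n → q ∣ n → ∃ λ a → val q n ≡ suc a
val≥1 {q} 1<q n>0 (divides m refl) = _ , val-* q m 1<q (*-positiveʳ q (subst (0 <_) (*-comm m q) n>0))

val≥2 : ∀ q m → 1 < q → 0 < m → ∃ λ a → val q (m * q * q) ≡ 2+ a
val≥2 1 m (s≤s ()) _
-- With these patterns the fuel left after the first division reduces to a successor, so a second
-- division can be carried out.
val≥2 q@(2+ _) m@(suc _) 1<q m>0 = _ , trans (val-* q (m * q) 1<q z<s) (cong suc (valAux-* _ q m 1<q m>0))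

Spp-suc : ∀ {r q} a → r < q → Spp r q (suc a) ≡ q ^ a * (q ∸ r)
Spp-suc {r} {q} a r<q with q ≤? r
... | yes q≤r = contradiction q≤r (<⇒≱ r<q)
... | no _    = refl

Spp-suc-positive⇒< : ∀ {r q} a → 0 < Spp r q (suc a) → r < q
Spp-suc-positive⇒< {r} {q} a Spp>0 with q ≤? r
... | no q≰r = ≰⇒> q≰r

-- Values of S_r at primes and products of two primes

primesUpTo : ℕ → List ℕ
primesUpTo n = filter prime? (upTo (suc n))

∈-primesUpTo : ∀ {q n} → Prime q → q ≤ n → q ∈ primesUpTo n
∈-primesUpTo q-prime q≤n = ∈-filter⁺ prime? (∈-upTo⁺ (s≤s q≤n)) q-prime

∈⇒↭∷ : ∀ {x : ℕ} {xs} → x ∈ xs → ∃ λ ys → xs ↭ x ∷ ys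
∈⇒↭∷ {x} x∈xs with ∈-∃++ x∈xs
... | ys , zs , refl = ys ++ zs , shift x ys zs

-- Moves two chosen primes to the front of the list over which `S` is a product.
∈∈⇒↭∷∷ : ∀ {x y : ℕ} {xs} → x ≢ y → x ∈ xs → y ∈ xs → ∃ λ ys → xs ↭ x ∷ y ∷ ys
∈∈⇒↭∷∷ {x} x≢y x∈xs y∈xs with ∈⇒↭∷ x∈xs
... | ys , xs↭ with ∈-resp-↭ xs↭ y∈xs
...   | here y≡x = contradiction (sym y≡x) x≢y
...   | there y∈ys with ∈⇒↭∷ y∈ys
...     | zs , ys↭ = zs , ↭-trans xs↭ (↭-prep x ys↭)

product-map-≡1 : ∀ (f : ℕ → ℕ) xs → (∀ {x} → x ∈ xs → f x ≡ 1) → product (map f xs) ≡ 1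
product-map-≡1 f []       _  = refl
product-map-≡1 f (x ∷ xs) f≡1 = cong₂ _*_ (f≡1 (here refl)) (product-map-≡1 f xs (λ x∈ → f≡1 (there x∈)))

local-factor : ℕ → ℕ → ℕ → ℕ
local-factor r n q = Spp r q (val q n)

S-↭ : ∀ r n {qs} → primesUpTo n ↭ qs → S r n ≡ product (map (local-factor r n) qs)
S-↭ r n ↭qs = product-↭ (map⁺ (local-factor r n) ↭qs)

Unique-primes : ∀ n {qs} → primesUpTo n ↭ qs → Unique qs
Unique-primes n ↭qs = Unique-resp-↭ (setoid ℕ) (↭⇒↭ₛ ↭qs) (filter⁺ prime? (upTo⁺ (suc n)))

∈-primes⇒prime : ∀ n {qs q} → primesUpTo n ↭ qs → q ∈ qs → Prime q
∈-primes⇒prime n ↭qs q∈qs = proj₂ (∈-filter⁻ prime? {xs = upTo (suc n)} (∈-resp-↭ (↭-sym ↭qs) q∈qs))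

local-factor-∤ : ∀ r n q → q ∤ n → local-factor r n q ≡ 1
local-factor-∤ r n q q∤n = cong (Spp r q) (valAux-∤ n q n q∤n)

local-factor-simple : ∀ {r q} m → Prime q → 0 < m → q ∤ m → r < q → local-factor r (m * q) q ≡ q ∸ r
local-factor-simple {r} {q} m q-prime m>0 q∤m r<q =
  trans (cong (Spp r q) (val≡1 q m (prime⇒>1 q-prime) m>0 q∤m))
        (trans (Spp-suc 0 r<q) (*-identityˡ (q ∸ r)))

-- Put `p` first in the list of primes. The list has no repetitions, so no prime in the tail divides
-- `p`, and each contributes `Spp r q 0`, which is 1 even for q ≤ r.
S-prime : ∀ {r p} → Prime p → r < p → S r p ≡ p ∸ r
S-prime {r} {p} p-prime r<p with ∈⇒↭∷ (∈-primesUpTo p-prime (≤-refl {p}))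
... | qs , ↭qs with Unique-primes p ↭qs
...   | p≢qs ∷ _ = begin
  S r p                                                  ≡⟨ S-↭ r p ↭qs ⟩
  local-factor r p p * product (map (local-factor r p) qs) ≡⟨ cong₂ _*_ at-p (product-map-≡1 _ qs elsewhere) ⟩
  (p ∸ r) * 1                                            ≡⟨ *-identityʳ (p ∸ r) ⟩
  p ∸ r                                                  ∎
  where
  open ≡-Reasoning
  at-p : local-factor r p p ≡ p ∸ r
  at-p = trans (cong (λ n → local-factor r n p) (sym (*-identityˡ p)))
               (local-factor-simple 1 p-prime z<s (>⇒∤ (prime⇒>1 p-prime)) r<p)
  elsewhere : ∀ {q} → q ∈ qs → local-factor r p q ≡ 1
  elsewhere {q} q∈qs = local-factor-∤ r p q λ q∣p →
    All.lookup p≢qs q∈qs (sym (prime∣prime⇒≡ (∈-primes⇒prime p ↭qs (there q∈qs)) p-prime q∣p))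

S-semiprime : ∀ {r p q} → Prime p → Prime q → p ≢ q → r < p → r < q → S r (p * q) ≡ (p ∸ r) * (q ∸ r)
S-semiprime {r} {p} {q} p-prime q-prime p≢q r<p r<q
  with ∈∈⇒↭∷∷ p≢q (∈-primesUpTo p-prime (m≤m*n p q {{prime⇒nonZero q-prime}}))
                  (∈-primesUpTo q-prime (m≤n*m q p {{prime⇒nonZero p-prime}}))
... | xs , ↭xs with Unique-primes (p * q) ↭xs
...   | (_ ∷ p≢xs) ∷ q≢xs ∷ _ = begin
  S r (p * q)                        ≡⟨ S-↭ r (p * q) ↭xs ⟩
  f p * (f q * product (map f xs))   ≡⟨ cong₂ (λ x y → x * (y * product (map f xs))) at-p at-q ⟩
  (p ∸ r) * ((q ∸ r) * product (map f xs))
                                     ≡⟨ cong (λ x → (p ∸ r) * ((q ∸ r) * x)) (product-map-≡1 f xs elsewhere) ⟩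
  (p ∸ r) * ((q ∸ r) * 1)            ≡⟨ cong ((p ∸ r) *_) (*-identityʳ (q ∸ r)) ⟩
  (p ∸ r) * (q ∸ r)                  ∎
  where
  open ≡-Reasoning
  f : ℕ → ℕ
  f = local-factor r (p * q)
  at-q : f q ≡ q ∸ r
  at-q = local-factor-simple p q-prime (prime⇒>0 p-prime)
           (λ q∣p → p≢q (sym (prime∣prime⇒≡ q-prime p-prime q∣p))) r<q
  at-p : f p ≡ p ∸ r
  at-p = trans (cong (λ n → local-factor r n p) (*-comm p q))
               (local-factor-simple q p-prime (prime⇒>0 q-prime) (λ p∣q → p≢q (prime∣prime⇒≡ p-prime q-prime p∣q)) r<p)
  elsewhere : ∀ {x} → x ∈ xs → f x ≡ 1
  elsewhere {x} x∈xs = local-factor-∤ r (p * q) x (prime∤* x-prime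
    (λ x∣p → All.lookup p≢xs x∈xs (sym (prime∣prime⇒≡ x-prime p-prime x∣p)))
    (λ x∣q → All.lookup q≢xs x∈xs (sym (prime∣prime⇒≡ x-prime q-prime x∣q))))
    where
    x-prime : Prime x
    x-prime = ∈-primes⇒prime (p * q) ↭xs (there (there x∈xs))

-- Lower bounds for S_r on B_r

module _ {r n : ℕ} (n∈B : B r n) where
  private
    n>0 = proj₁ n∈B
    S>0 = proj₂ n∈B
    instance
      n≢0 : NonZero n
      n≢0 = >-nonZero n>0
      S≢0 : NonZero (S r n)
      S≢0 = >-nonZero S>0
    f = local-factor r n

  local-factor-≤ : ∀ {q} → Prime q → q ∣ n → f q ≤ S r n
  local-factor-≤ q-prime q∣n = ∣⇒≤ (∈⇒∣product (∈-map⁺ f (∈-primesUpTo q-prime (∣⇒≤ q∣n))))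

  local-factors-≤ : ∀ {q q′} → Prime q → Prime q′ → q ≢ q′ → q ∣ n → q′ ∣ n → f q * f q′ ≤ S r n
  local-factors-≤ {q} {q′} q-prime q′-prime q≢q′ q∣n q′∣n
    with ∈∈⇒↭∷∷ q≢q′ (∈-primesUpTo q-prime (∣⇒≤ q∣n)) (∈-primesUpTo q′-prime (∣⇒≤ q′∣n))
  ... | qs , ↭qs = ∣⇒≤ (divides (product (map f qs)) (trans (S-↭ r n ↭qs) (rearrange (f q) (f q′) (product (map f qs)))))
    where
    rearrange : ∀ x y z → x * (y * z) ≡ z * (x * y)
    rearrange = solve-∀

  -- The local factor at `q` divides the positive number `S r n`, whereas it would be 0 if q ≤ r.
  ∈B⇒<prime-divisor : ∀ {q} → Prime q → q ∣ n → r < q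
  ∈B⇒<prime-divisor {q} q-prime q∣n with val≥1 (prime⇒>1 q-prime) n>0 q∣n
  ... | a , val≡ = Spp-suc-positive⇒< a (subst (λ v → 0 < Spp r q v) val≡ f>0)
    where
    f>0 : 0 < f q
    f>0 with ∈⇒∣product (∈-map⁺ f (∈-primesUpTo q-prime (∣⇒≤ q∣n)))
    ... | divides y S≡ = *-positiveʳ y (subst (0 <_) S≡ S>0)

  ∸≤local-factor : ∀ {q} → Prime q → q ∣ n → q ∸ r ≤ f q
  ∸≤local-factor {q} q-prime q∣n with val≥1 (prime⇒>1 q-prime) n>0 q∣n
  ... | a , val≡ = ≤-trans (m≤n*m (q ∸ r) (q ^ a) {{>-nonZero (^-positive (prime⇒>0 q-prime) a)}})
                     (≤-reflexive (sym (trans (cong (Spp r q) val≡) (Spp-suc a (∈B⇒<prime-divisor q-prime q∣n)))))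

square-factor-≤ : ∀ {r} m {q} → B r (m * q * q) → Prime q → q * (q ∸ r) ≤ S r (m * q * q)
square-factor-≤ {r} m {q} n∈B q-prime with val≥2 q m (prime⇒>1 q-prime) m>0
  where
  m>0 : 0 < m
  m>0 = *-positiveʳ (q * q) (subst (0 <_) (trans (*-assoc m q q) (*-comm m (q * q))) (proj₁ n∈B))
... | a , val≡ = begin
  q * (q ∸ r)                  ≤⟨ *-monoˡ-≤ (q ∸ r) (m≤m*n q (q ^ a) {{>-nonZero (^-positive (prime⇒>0 q-prime) a)}}) ⟩
  q ^ suc a * (q ∸ r)          ≡⟨ Spp-suc (suc a) (∈B⇒<prime-divisor n∈B q-prime q∣n) ⟨
  Spp r q (2+ a)               ≡⟨ cong (Spp r q) val≡ ⟨
  local-factor r (m * q * q) q ≤⟨ local-factor-≤ n∈B q-prime q∣n ⟩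
  S r (m * q * q)              ∎
  where
  open ≤-Reasoning
  q∣n : q ∣ m * q * q
  q∣n = n∣m*n (m * q)

-- Composite elements of B_r and the bound on primes in F_r

module _ {r q₁ q₂ : ℕ} (1≤r : 1 ≤ r) (next₁ : IsNextPrime r q₁) (next₂ : IsNextPrime q₁ q₂) where
  private
    q₁-prime = proj₁ next₁
    q₂-prime = proj₁ next₂
    r<q₁ = proj₁ (proj₂ next₁)
    q₁<q₂ = proj₁ (proj₂ next₂)
    q₂≤1+2r = second-next-prime-≤ next₁ next₂ 1≤r

  composite-S-≥ : ∀ {m} → B r m → 1 < m → ¬ Prime m → (q₁ ∸ r) * (q₂ ∸ r) ≤ S r m
  composite-S-≥ {m} m∈B 1<m ¬prime with ∃-prime-divisor m 1<m
  ... | q , q-prime , q∣m@(divides k refl) with ∃-prime-divisor k 1<k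
    where
    1<k : 1 < k
    1<k = ≰⇒> λ where
      z≤n       → contradiction 1<m λ ()
      (s≤s z≤n) → ¬prime (subst Prime (sym (*-identityˡ q)) q-prime)
  ... | q′ , q′-prime , q′∣k with <-cmp q q′
  ...   | tri< q<q′ q≢q′ _ = ≤-trans
    (*-mono-≤ (∸-monoˡ-≤ r q₁≤q) (∸-monoˡ-≤ r q₂≤q′))
    (≤-trans (*-mono-≤ (∸≤local-factor m∈B q-prime q∣m) (∸≤local-factor m∈B q′-prime q′∣m))
             (local-factors-≤ m∈B q-prime q′-prime q≢q′ q∣m q′∣m))
    where
    q′∣m : q′ ∣ k * q
    q′∣m = ∣m⇒∣m*n q q′∣k
    q₁≤q : q₁ ≤ q
    q₁≤q = next-prime-minimal next₁ q-prime (∈B⇒<prime-divisor m∈B q-prime q∣m)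
    q₂≤q′ : q₂ ≤ q′
    q₂≤q′ = next-prime-minimal next₂ q′-prime (≤-<-trans q₁≤q q<q′)
  ...   | tri> _ q≢q′ q′<q = ≤-trans
    (*-mono-≤ (∸-monoˡ-≤ r q₁≤q′) (∸-monoˡ-≤ r q₂≤q))
    (≤-trans (*-mono-≤ (∸≤local-factor m∈B q′-prime q′∣m) (∸≤local-factor m∈B q-prime q∣m))
             (local-factors-≤ m∈B q′-prime q-prime (λ q′≡q → q≢q′ (sym q′≡q)) q′∣m q∣m))
    where
    q′∣m : q′ ∣ k * q
    q′∣m = ∣m⇒∣m*n q q′∣k
    q₁≤q′ : q₁ ≤ q′
    q₁≤q′ = next-prime-minimal next₁ q′-prime (∈B⇒<prime-divisor m∈B q′-prime q′∣m)
    q₂≤q : q₂ ≤ q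
    q₂≤q = next-prime-minimal next₂ q-prime (≤-<-trans q₁≤q′ q′<q)
  -- The two prime divisors coincide, so q² divides m and the local factor at q is at least q (q -
  -- r).
  ...   | tri≈ _ refl _ with q′∣k
  ...     | divides j refl = begin
    (q₁ ∸ r) * (q₂ ∸ r)  ≤⟨ *-mono-≤ (∸-monoˡ-≤ r q₁≤q) (≤-trans q₂∸r≤q₁ q₁≤q) ⟩
    (q ∸ r) * q          ≡⟨ *-comm (q ∸ r) q ⟩
    q * (q ∸ r)          ≤⟨ square-factor-≤ j m∈B q-prime ⟩
    S r (j * q * q)      ∎
    where
    open ≤-Reasoning
    q₁≤q : q₁ ≤ q
    q₁≤q = next-prime-minimal next₁ q-prime (∈B⇒<prime-divisor m∈B q-prime q∣m)
    -- Here two primes in (r, 2r + 1] are used: q₂ - r ≤ r + 1 ≤ q₁.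
    q₂∸r≤q₁ : q₂ ∸ r ≤ q₁
    q₂∸r≤q₁ = ≤-trans (m≤n+o⇒m∸n≤o q₂ r (≤-trans q₂≤1+2r (≤-reflexive (sym (+-suc r r))))) r<q₁

  semiprime∈B : ∀ {q} → Prime q → q₁ < q → B r (q₁ * q)
  semiprime∈B q-prime q₁<q =
    *-positive (prime⇒>0 q₁-prime) (prime⇒>0 q-prime) ,
    subst (0 <_) (sym (S-semiprime q₁-prime q-prime (<⇒≢ q₁<q) r<q₁ (<-trans r<q₁ q₁<q)))
          (*-positive (m<n⇒0<n∸m r<q₁) (m<n⇒0<n∸m (<-trans r<q₁ q₁<q)))

  -- The element `q₁ * q` of B_r exceeds `p` and has totient (q₁ - r)(q - r). The prime `q` is left
  -- free: it is q₂ in the theorem and the prime after ⌊p/q₁⌋ in `F⇒<q₁q₂`.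
  semiprime-bound : ∀ {p q} → F r p → Prime p → r < p → Prime q → q₁ < q → p < q₁ * q →
                    p < (q₁ ∸ r) * (q ∸ r) + r
  semiprime-bound {p} {q} (_ , minimal) p-prime r<p q-prime q₁<q p<q₁q = begin-strict
    p                          ≡⟨ m∸n+n≡m (<⇒≤ r<p) ⟨
    p ∸ r + r                  ≡⟨ cong (_+ r) (S-prime p-prime r<p) ⟨
    S r p + r                  <⟨ +-monoˡ-< r (minimal (q₁ * q) (semiprime∈B q-prime q₁<q) p<q₁q) ⟩
    S r (q₁ * q) + r           ≡⟨ cong (_+ r) (S-semiprime q₁-prime q-prime (<⇒≢ q₁<q) r<q₁ (<-trans r<q₁ q₁<q)) ⟩
    (q₁ ∸ r) * (q ∸ r) + r     ∎
    where open ≤-Reasoning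

  F⇒<q₁q₂ : ∀ {p} → F r p → Prime p → r < p → p < q₁ * q₂
  F⇒<q₁q₂ {p} p∈F p-prime r<p = ≰⇒> impossible
    where
    instance _ = prime⇒nonZero q₁-prime
    open ≤-Reasoning
    n = p / q₁
    p<q₁[1+n] : p < q₁ * suc n
    p<q₁[1+n] = begin-strict
      p               ≡⟨ m≡m%n+[m/n]*n p q₁ ⟩
      p % q₁ + n * q₁ <⟨ +-monoˡ-< (n * q₁) (m%n<n p q₁) ⟩
      suc n * q₁      ≡⟨ *-comm (suc n) q₁ ⟩
      q₁ * suc n      ∎
    q₁≤2r : q₁ ≤ r + r
    q₁≤2r = s≤s⁻¹ (≤-trans q₁<q₂ q₂≤1+2r)
    impossible : ¬ q₁ * q₂ ≤ p
    impossible q₁q₂≤p with ∃-next-prime n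
    ... | q , next@(q-prime , n<q , _) with ∃-next-prime q
    ...   | q⁺ , next⁺@(_ , q<q⁺ , _) = <⇒≱
      (semiprime-bound p∈F p-prime r<p q-prime q₁<q (<-≤-trans p<q₁[1+n] (*-monoʳ-≤ q₁ n<q)))
      (begin
        -- With c = q₁ - r, the bound c ≥ 1 absorbs the added r; below, c ≤ r gives 2c ≤ q₁ and
        -- absorbs the factor 2 of q ≤ 2n.
        c * (q ∸ r) + r        ≤⟨ +-monoʳ-≤ (c * (q ∸ r)) (m≤n*m r c {{>-nonZero c>0}}) ⟩
        c * (q ∸ r) + c * r    ≡⟨ *-distribˡ-+ c (q ∸ r) r ⟨
        c * (q ∸ r + r)        ≡⟨ cong (c *_) (m∸n+n≡m (<⇒≤ (<-trans r<q₁ q₁<q))) ⟩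
        c * q                  ≤⟨ *-monoʳ-≤ c q≤2n ⟩
        c * (n + n)            ≡⟨ *-distribˡ-+ c n n ⟩
        c * n + c * n          ≤⟨ +-monoʳ-≤ (c * n) (*-monoˡ-≤ n c≤r) ⟩
        c * n + r * n          ≡⟨ *-distribʳ-+ n c r ⟨
        (c + r) * n            ≡⟨ cong (_* n) (m∸n+n≡m (<⇒≤ r<q₁)) ⟩
        q₁ * n                 ≡⟨ *-comm q₁ n ⟩
        n * q₁                 ≤⟨ m/n*n≤m p q₁ ⟩
        p                      ∎)
      where
      c = q₁ ∸ r
      c>0 : 0 < c
      c>0 = m<n⇒0<n∸m r<q₁
      c≤r : c ≤ r
      c≤r = m≤n+o⇒m∸n≤o q₁ r q₁≤2r
      q₂≤n : q₂ ≤ n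
      q₂≤n = s≤s⁻¹ (*-cancelˡ-< q₁ q₂ (suc n) (≤-<-trans q₁q₂≤p p<q₁[1+n]))
      q₁<q : q₁ < q
      q₁<q = <-trans (<-≤-trans q₁<q₂ q₂≤n) n<q
      q≤2n : q ≤ n + n
      -- The second prime after n is at most 2n + 1, so the first is at most 2n.
      q≤2n = s≤s⁻¹ (≤-trans q<q⁺ (second-next-prime-≤ next next⁺ (≤-trans (prime⇒>0 q₂-prime) q₂≤n)))

theorem3p1 : (p r : ℕ) → Prime p → 1 ≤ r →
    (q₁ q₂ : ℕ) → IsNextPrime r q₁ → IsNextPrime q₁ q₂ →
    (F r p ⇔ ((r < p) × (p < (q₁ ∸ r) * (q₂ ∸ r) + r)))
theorem3p1 p r p-prime 1≤r q₁ q₂ next₁ next₂ = mk⇔ to from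
  where
  to : F r p → (r < p) × (p < (q₁ ∸ r) * (q₂ ∸ r) + r)
  to p∈F@(p∈B , _) = r<p , semiprime-bound 1≤r next₁ next₂ p∈F p-prime r<p (proj₁ next₂)
    (proj₁ (proj₂ next₂)) (F⇒<q₁q₂ 1≤r next₁ next₂ p∈F p-prime r<p)
    where
    r<p : r < p
    r<p = ∈B⇒<prime-divisor p∈B p-prime ∣-refl
  from : (r < p) × (p < (q₁ ∸ r) * (q₂ ∸ r) + r) → F r p
  from (r<p , p<bound) = (prime⇒>0 p-prime , subst (0 <_) (sym Sp≡) (m<n⇒0<n∸m r<p)) , smaller
    where
    Sp≡ : S r p ≡ p ∸ r
    Sp≡ = S-prime p-prime r<p
    smaller : ∀ m → B r m → p < m → S r p < S r m
    smaller m m∈B p<m with prime? m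
    ... | yes m-prime = subst₂ _<_ (sym Sp≡) (sym (S-prime m-prime (<-trans r<p p<m))) (∸-monoˡ-< p<m (<⇒≤ r<p))
    -- S_r p = p - r < (q₁ - r)(q₂ - r) ≤ S_r m, where the first inequality is the hypothesis with r
    -- cancelled.
    ... | no ¬prime = <-≤-trans
      (+-cancelʳ-< r (S r p) _ (subst (_< (q₁ ∸ r) * (q₂ ∸ r) + r) p≡ p<bound))
      (composite-S-≥ 1≤r next₁ next₂ m∈B (<-trans (prime⇒>1 p-prime) p<m) ¬prime)
      where
      p≡ : p ≡ S r p + r
      p≡ = trans (sym (m∸n+n≡m (<⇒≤ r<p))) (cong (_+ r) (sym Sp≡))
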